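{- For all rational numbers $u,v$, define $$\begin{aligned} x_1&=-98u^4-1007u^3v+1804u^2v^2+687uv^3+774v^4,\\ x_2&=2u^4+858u^3v-2396u^2v^2-1518uv^3+1314v^4,\\ x_3&=-128u^4+308u^3v+1404u^2v^2+132uv^3+144v^4,\\ x_4&=122u^4+853u^3v-1056u^2v^2-753uv^3-1206v^4,\\ x_5&=102u^4-1012u^3v+244u^2v^2+1452uv^3-1026v^4,\\ y_1&=102u^4+1133u^3v-2096u^2v^2-693uv^3+1314v^4,\\ y_2&=122u^4-642u^3v+1804u^2v^2+1782uv^3-1206v^4,\\ y_3&=-128u^4-572u^3v-56u^2v^2+2772uv^3+144v^4,\\ y_4&=2u^4-407u^3v+1404u^2v^2-2013uv^3-1026v^4,\\ y_5&=-98u^4+488u^3v-1056u^2v^2-1848uv^3+774v^4. \end{aligned}$$ Then $\sum_{i=1}^5x_i=\sum_{i=1}^5y_i=0$ and $$\sum_{i=1}^5x_i^r=\sum_{i=1}^5y_i^r\qquad\text{for } r=1,2,3,4,6.$$ Moreover, as a parametric solution this is nontrivial and nonsymmetric: in $\mathbb{Q}[u,v]$ the multiset $\{y_1,\dots,y_5\}$ is equal neither to the multiset $\{x_1,\dots,x_5\}$ nor to the multiset $\{ -x_1,\dots,-x_5\}$.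
   Context: An ideal solution of the Tarry-Escott problem of degree $k$ consists of two distinct multisets $\{x_1,\dots,x_{k+1}\}$, $\{y_1,\dots,y_{k+1}\}$ with $\sum x_i^r=\sum y_i^r$ for $r=1,\dots,k$. For $k=4$, a solution with $\sum x_i=\sum y_i=0$ is symmetric if, after rearrangement, $x_i=-y_i$ for all $i$, and nonsymmetric otherwise. -}

module Defs where

open import Agda.Builtin.FromNat using (Number; fromNat)
open import Agda.Builtin.FromNeg using (Negative; fromNeg)
open import Algebra.Bundles using (RawRing)
import Algebra.Definitions.RawSemiring as RawSemiringDefinitions
open import Data.Bool.Base using (if_then_else_; _∧_)
open import Data.Integer.Base using (ℤ)
import Data.Integer.Literals as ℤLiterals
open import Data.List.Base using (List; []; _∷_; _++_; map; foldr; cartesianProductWith)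
import Data.List.Relation.Binary.Permutation.Setoid as SetoidPermutation
open import Data.Nat.Base as ℕ using (ℕ)
import Data.Nat.Literals as ℕLiterals
open import Data.Nat.Properties using (_≟_)
open import Data.Rational.Base as ℚ using (ℚ; 0ℚ; 1ℚ)
-- The instance tt discharges the (trivial) constraints on overloaded literals.
open import Data.Unit.Base using (tt)
open import Level using (0ℓ)
open import Relation.Binary.Bundles using (Setoid)
open import Relation.Binary.PropositionalEquality using (_≡_; refl; sym; trans)
open import Relation.Nullary.Decidable using (⌊_⌋)

private
  instance
    ℕ-number : Number ℕ
    ℕ-number = ℕLiterals.number

    ℤ-number : Number ℤ
    ℤ-number = ℤLiterals.number

    ℤ-negative : Negative ℤ
    ℤ-negative = ℤLiterals.negative

fromℤ : ℤ → ℚ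
fromℤ z = z ℚ./ 1

-- The same formulas are used over ℚ (u, v rational numbers) and over ℚ[u,v]
-- (u, v the indeterminates); ι interprets the integer coefficients.

module Forms {c ℓ} (R : RawRing c ℓ) (ι : ℤ → RawRing.Carrier R) where

  open RawRing R
  open RawSemiringDefinitions rawSemiring using (_^_)

  quartic : ℤ → ℤ → ℤ → ℤ → ℤ → Carrier → Carrier → Carrier
  quartic a b c d e u v =
      ι a * u ^ 4
    + ι b * (u ^ 3 * v)
    + ι c * (u ^ 2 * v ^ 2)
    + ι d * (u * v ^ 3)
    + ι e * v ^ 4

  x₁ x₂ x₃ x₄ x₅ y₁ y₂ y₃ y₄ y₅ : Carrier → Carrier → Carrier

  x₁ = quartic  -98 -1007  1804   687   774
  x₂ = quartic    2   858 -2396 -1518  1314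
  x₃ = quartic -128   308  1404   132   144
  x₄ = quartic  122   853 -1056  -753 -1206
  x₅ = quartic  102 -1012   244  1452 -1026

  y₁ = quartic  102  1133 -2096  -693  1314
  y₂ = quartic  122  -642  1804  1782 -1206
  y₃ = quartic -128  -572   -56  2772   144
  y₄ = quartic    2  -407  1404 -2013 -1026
  y₅ = quartic  -98   488 -1056 -1848   774

  xs ys : Carrier → Carrier → List Carrier
  xs u v = x₁ u v ∷ x₂ u v ∷ x₃ u v ∷ x₄ u v ∷ x₅ u v ∷ []
  ys u v = y₁ u v ∷ y₂ u v ∷ y₃ u v ∷ y₄ u v ∷ y₅ u v ∷ []

sumℚ : List ℚ → ℚ
sumℚ = foldr ℚ._+_ 0ℚ

powerSum : ℕ → List ℚ → ℚ
powerSum r qs = sumℚ (map (_^ r) qs)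
  where open RawSemiringDefinitions (RawRing.rawSemiring ℚ.+-*-rawRing) using (_^_)

-- ℚ[u,v]: a polynomial is represented by a formal sum of terms, possibly with
-- repeated monomials or zero coefficients.  Equality _≈ₚ_ compares the total
-- coefficient of every monomial, so that the quotient is ℚ[u,v].

record Term : Set where
  constructor _·u^_v^_
  field
    coefficient : ℚ
    uExponent   : ℕ
    vExponent   : ℕ

open Term

ℚ[u,v] : Set
ℚ[u,v] = List Term

coeff : ℚ[u,v] → ℕ → ℕ → ℚ
coeff []      i j = 0ℚ
coeff (t ∷ p) i j =
  (if ⌊ uExponent t ≟ i ⌋ ∧ ⌊ vExponent t ≟ j ⌋ then coefficient t else 0ℚ)
  ℚ.+ coeff p i j

infix 4 _≈ₚ_

_≈ₚ_ : ℚ[u,v] → ℚ[u,v] → Set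
p ≈ₚ q = ∀ i j → coeff p i j ≡ coeff q i j

_*ₜ_ : Term → Term → Term
(a ·u^ i v^ j) *ₜ (b ·u^ k v^ l) = (a ℚ.* b) ·u^ (i ℕ.+ k) v^ (j ℕ.+ l)

_*ₚ_ : ℚ[u,v] → ℚ[u,v] → ℚ[u,v]
_*ₚ_ = cartesianProductWith _*ₜ_

-ₚ_ : ℚ[u,v] → ℚ[u,v]
-ₚ_ = map λ t → record t { coefficient = ℚ.- coefficient t }

constₚ : ℚ → ℚ[u,v]
constₚ q = (q ·u^ 0 v^ 0) ∷ []

U V : ℚ[u,v]
U = (1ℚ ·u^ 1 v^ 0) ∷ []
V = (1ℚ ·u^ 0 v^ 1) ∷ []

ℚ[u,v]-rawRing : RawRing 0ℓ 0ℓ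
ℚ[u,v]-rawRing = record
  { Carrier = ℚ[u,v]
  ; _≈_     = _≈ₚ_
  ; _+_     = _++_
  ; _*_     = _*ₚ_
  ; -_      = -ₚ_
  ; 0#      = []
  ; 1#      = constₚ 1ℚ
  }

ℚ[u,v]-setoid : Setoid 0ℓ 0ℓ
ℚ[u,v]-setoid = record
  { Carrier       = ℚ[u,v]
  ; _≈_           = _≈ₚ_
  ; isEquivalence = record
    { refl  = λ _ _ → refl
    ; sym   = λ p≈q i j → sym (p≈q i j)
    ; trans = λ p≈q q≈r i j → trans (p≈q i j) (q≈r i j)
    }
  }

-- Equality of finite multisets of polynomials.
open SetoidPermutation ℚ[u,v]-setoid public using () renaming (_↭_ to _↭ₚ_)

module Rational   = Forms ℚ.+-*-rawRing fromℤ
module Parametric = Forms ℚ[u,v]-rawRing (λ z → constₚ (fromℤ z))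

{-# OPTIONS --safe #-}

-- The power sum identities are polynomial identities with integer coefficients:
-- they hold because both sides have the same normal form in ℤ[u,v], and they are
-- then evaluated at rational u, v.  For the last two claims it is enough that
-- the coefficient of u³v in y₁ is 1133, and that it is ±1133 in none of the xᵢ.

module Submission where

open import Defs
open import Algebra.Bundles using (RawRing)
import Algebra.Solver.Ring as RingSolver
open import Algebra.Solver.Ring.AlmostCommutativeRing
  using (AlmostCommutativeRing; fromCommutativeRing; _-Raw-AlmostCommutative⟶_)
open import Data.Fin.Base using (zero; suc)
open import Data.Integer.Base as ℤ using (0ℤ; 1ℤ)
import Data.Integer.Properties as ℤ
open import Data.List.Base using (List; []; _∷_; map; foldr)
open import Data.List.Membership.Propositional using (_∈_)
import Data.List.Relation.Binary.Permutation.Setoid.Properties as Permutation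
open import Data.List.Relation.Unary.All as All using (All; []; _∷_)
open import Data.List.Relation.Unary.Any using (Any; here; any?)
import Data.Maybe.Base as Maybe
open import Data.Nat.Base using (ℕ)
open import Data.Product.Base using (_×_; _,_)
open import Data.Rational.Base as ℚ using (ℚ; 0ℚ; toℚᵘ)
import Data.Rational.Properties as ℚ
open import Data.Rational.Unnormalised.Base as ℚᵘ using (mkℚᵘ)
import Data.Rational.Unnormalised.Properties as ℚᵘ
open import Data.Vec.Base using (Vec; []; _∷_)
open import Level using (0ℓ)
open import Relation.Binary.PropositionalEquality
  using (_≡_; refl; sym; trans; cong; cong₂)
open import Relation.Nullary.Decidable using (from-no; dec⇒maybe)
open import Relation.Nullary.Negation using (¬_; contraposition)

-- Division in ℚ reduces by a gcd, which is stuck on a variable numerator. Unnormalised fractions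
-- involve no gcd, so the homomorphism laws are proved there and pulled back along the injective
-- `toℚᵘ`.
toℚᵘ-fromℤ : ∀ m → toℚᵘ (fromℤ m) ℚᵘ.≃ mkℚᵘ m 0
toℚᵘ-fromℤ m = ℚ.toℚᵘ-fromℚᵘ (mkℚᵘ m 0)

fromℤ-homo-+ : ∀ m n → fromℤ (m ℤ.+ n) ≡ fromℤ m ℚ.+ fromℤ n
fromℤ-homo-+ m n = ℚ.toℚᵘ-injective (begin
  toℚᵘ (fromℤ (m ℤ.+ n))              ≈⟨ toℚᵘ-fromℤ (m ℤ.+ n) ⟩
  -- Cross-multiplying over the denominators 1 gives the numerator `m * 1 + n * 1`.
  mkℚᵘ (m ℤ.+ n) 0                    ≡⟨ cong₂ (λ i j → mkℚᵘ (i ℤ.+ j) 0) (ℤ.*-identityʳ m) (ℤ.*-identityʳ n) ⟨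
  mkℚᵘ m 0 ℚᵘ.+ mkℚᵘ n 0              ≈⟨ ℚᵘ.+-cong (toℚᵘ-fromℤ m) (toℚᵘ-fromℤ n) ⟨
  toℚᵘ (fromℤ m) ℚᵘ.+ toℚᵘ (fromℤ n)  ≈⟨ ℚ.toℚᵘ-homo-+ (fromℤ m) (fromℤ n) ⟨
  toℚᵘ (fromℤ m ℚ.+ fromℤ n)          ∎)
  where open import Relation.Binary.Reasoning.Setoid ℚᵘ.≃-setoid

fromℤ-homo-* : ∀ m n → fromℤ (m ℤ.* n) ≡ fromℤ m ℚ.* fromℤ n
fromℤ-homo-* m n = ℚ.toℚᵘ-injective (begin
  toℚᵘ (fromℤ (m ℤ.* n))              ≈⟨ toℚᵘ-fromℤ (m ℤ.* n) ⟩
  mkℚᵘ m 0 ℚᵘ.* mkℚᵘ n 0              ≈⟨ ℚᵘ.*-cong (toℚᵘ-fromℤ m) (toℚᵘ-fromℤ n) ⟨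
  toℚᵘ (fromℤ m) ℚᵘ.* toℚᵘ (fromℤ n)  ≈⟨ ℚ.toℚᵘ-homo-* (fromℤ m) (fromℤ n) ⟨
  toℚᵘ (fromℤ m ℚ.* fromℤ n)          ∎)
  where open import Relation.Binary.Reasoning.Setoid ℚᵘ.≃-setoid

fromℤ-homo-neg : ∀ m → fromℤ (ℤ.- m) ≡ ℚ.- fromℤ m
fromℤ-homo-neg m = ℚ.toℚᵘ-injective (begin
  toℚᵘ (fromℤ (ℤ.- m))   ≈⟨ toℚᵘ-fromℤ (ℤ.- m) ⟩
  ℚᵘ.- mkℚᵘ m 0          ≈⟨ ℚᵘ.-‿cong (toℚᵘ-fromℤ m) ⟨
  ℚᵘ.- toℚᵘ (fromℤ m)    ≈⟨ ℚ.toℚᵘ-homo‿- (fromℤ m) ⟨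
  toℚᵘ (ℚ.- fromℤ m)     ∎)
  where open import Relation.Binary.Reasoning.Setoid ℚᵘ.≃-setoid

ℚ-ring : AlmostCommutativeRing 0ℓ 0ℓ
ℚ-ring = fromCommutativeRing ℚ.+-*-commutativeRing

fromℤ-morphism : ℤ.+-*-rawRing -Raw-AlmostCommutative⟶ ℚ-ring
fromℤ-morphism = record
  { ⟦_⟧    = fromℤ
  ; +-homo = fromℤ-homo-+
  ; *-homo = fromℤ-homo-*
  ; -‿homo = fromℤ-homo-neg
  ; 0-homo = refl
  ; 1-homo = refl
  }

-- Coefficients live in ℤ and values in ℚ, so normal forms are computed by integer arithmetic,
-- without fractions.
open RingSolver ℤ.+-*-rawRing ℚ-ring fromℤ-morphism
  (λ m n → Maybe.map (cong fromℤ) (dec⇒maybe (m ℤ.≟ n)))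
  using (Polynomial; con; var; _:+_; _:*_; :-_; _:^_; ⟦_⟧; normalise; ⟦_⟧N; correct)

Polynomial-rawRing : ℕ → RawRing 0ℓ 0ℓ
Polynomial-rawRing n = record
  { Carrier = Polynomial n
  ; _≈_     = _≡_
  ; _+_     = _:+_
  ; _*_     = _:*_
  ; -_      = :-_
  ; 0#      = con 0ℤ
  ; 1#      = con 1ℤ
  }

-- Over syntactic polynomials, so that ⟦_⟧ maps these forms to the ones in Rational
-- by computation alone.
module Symbolic = Forms (Polynomial-rawRing 2) con

xsₑ ysₑ : List (Polynomial 2)
xsₑ = Symbolic.xs (var zero) (var (suc zero))
ysₑ = Symbolic.ys (var zero) (var (suc zero))

sumₑ : ∀ {n} → List (Polynomial n) → Polynomial n
sumₑ = foldr _:+_ (con 0ℤ)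

powerSumₑ : ∀ {n} → ℕ → List (Polynomial n) → Polynomial n
powerSumₑ r es = sumₑ (map (_:^ r) es)

⟦sumₑ⟧ : ∀ {n} es (ρ : Vec ℚ n) →
  ⟦ sumₑ es ⟧ ρ ≡ sumℚ (map (λ e → ⟦ e ⟧ ρ) es)
⟦sumₑ⟧ []       ρ = refl
⟦sumₑ⟧ (e ∷ es) ρ = cong (⟦ e ⟧ ρ ℚ.+_) (⟦sumₑ⟧ es ρ)

⟦powerSumₑ⟧ : ∀ {n} r es (ρ : Vec ℚ n) →
  ⟦ powerSumₑ r es ⟧ ρ ≡ powerSum r (map (λ e → ⟦ e ⟧ ρ) es)
⟦powerSumₑ⟧ r []       ρ = refl
-- `:^` evaluates definitionally to the power used in `powerSum`, so only the tails need an
-- argument.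
⟦powerSumₑ⟧ r (e ∷ es) ρ = cong (⟦ e :^ r ⟧ ρ ℚ.+_) (⟦powerSumₑ⟧ r es ρ)

-- By `correct`, an expression and its normal form have the same value at every `ρ`. An identity for
-- all rational `u`, `v` thus reduces to one closed computation.
normalise-sound : ∀ {n} (p q : Polynomial n) → normalise p ≡ normalise q →
                  ∀ ρ → ⟦ p ⟧ ρ ≡ ⟦ q ⟧ ρ
normalise-sound p q eq ρ =
  trans (sym (correct p ρ)) (trans (cong (λ e → ⟦ e ⟧N ρ) eq) (correct q ρ))

-- Normal forms compute only for a concrete exponent, hence a table with one `refl` per exponent.
-- The last one compares forms of degree 24 in `u` and `v`.
powerSums-normalise : All (λ r → normalise (powerSumₑ r xsₑ) ≡ normalise (powerSumₑ r ysₑ))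
                          (1 ∷ 2 ∷ 3 ∷ 4 ∷ 6 ∷ [])
powerSums-normalise = refl ∷ refl ∷ refl ∷ refl ∷ refl ∷ []

sum-xs : ∀ u v → sumℚ (Rational.xs u v) ≡ 0ℚ
sum-xs u v = trans (sym (⟦sumₑ⟧ xsₑ (u ∷ v ∷ [])))
                   (normalise-sound (sumₑ xsₑ) (con 0ℤ) refl (u ∷ v ∷ []))

sum-ys : ∀ u v → sumℚ (Rational.ys u v) ≡ 0ℚ
sum-ys u v = trans (sym (⟦sumₑ⟧ ysₑ (u ∷ v ∷ [])))
                   (normalise-sound (sumₑ ysₑ) (con 0ℤ) refl (u ∷ v ∷ []))

powerSums : ∀ u v r → r ∈ (1 ∷ 2 ∷ 3 ∷ 4 ∷ 6 ∷ []) →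
            powerSum r (Rational.xs u v) ≡ powerSum r (Rational.ys u v)
powerSums u v r r∈ =
  trans (sym (⟦powerSumₑ⟧ r xsₑ (u ∷ v ∷ [])))
    (trans (normalise-sound (powerSumₑ r xsₑ) (powerSumₑ r ysₑ)
                            (All.lookup powerSums-normalise r∈) (u ∷ v ∷ []))
           (⟦powerSumₑ⟧ r ysₑ (u ∷ v ∷ [])))

-- Agreeing with `p` in one fixed coefficient respects `_≈ₚ_`, so it is carried along a permutation
-- from the head `p` to some entry of `qs`.
↭ₚ⇒coeff∈ : ∀ i j {p ps qs} → (p ∷ ps) ↭ₚ qs → Any (λ q → coeff p i j ≡ coeff q i j) qs
↭ₚ⇒coeff∈ i j {p} σ = Any-resp-↭ (λ q≈r p≡q → trans p≡q (q≈r i j)) σ (here refl)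
  where open Permutation ℚ[u,v]-setoid using (Any-resp-↭)

mainTheorem2 : ((u v : ℚ) →
    (sumℚ (Rational.xs u v) ≡ 0ℚ) ×
    (sumℚ (Rational.ys u v) ≡ 0ℚ) ×
    ((r : ℕ) → r ∈ (1 ∷ 2 ∷ 3 ∷ 4 ∷ 6 ∷ []) →
    powerSum r (Rational.xs u v) ≡ powerSum r (Rational.ys u v)))
    × (¬ (Parametric.ys U V ↭ₚ Parametric.xs U V))
    × (¬ (Parametric.ys U V ↭ₚ map -ₚ_ (Parametric.xs U V)))
mainTheorem2 =
    (λ u v → sum-xs u v , sum-ys u v , powerSums u v)
  , contraposition (↭ₚ⇒coeff∈ 3 1)
      -- The search evaluates to `no`: the entries have coefficients -1007, 858, 308, 853 and -1012.
      -- Below, the same five occur with opposite signs.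
      (from-no (any? (λ q → coeff (Parametric.y₁ U V) 3 1 ℚ.≟ coeff q 3 1)
                     (Parametric.xs U V)))
  , contraposition (↭ₚ⇒coeff∈ 3 1)
      (from-no (any? (λ q → coeff (Parametric.y₁ U V) 3 1 ℚ.≟ coeff q 3 1)
                     (map -ₚ_ (Parametric.xs U V))))
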